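{- If $G$ is one of the following graphs, then $mvd(G)=2$: (i) the grid $G=P_m\Box P_n$ where either $m,n\geq 2$, or $\{m,n\}=\{1,2\}$; (ii) the Petersen graph.
   Context: $P_m$ is the path on $m$ vertices. $G\Box H$ is the Cartesian product: vertex set $V(G)\times V(H)$, with $(u,v)$ adjacent to $(u',v')$ iff either $u=u'$ and $vv'\in E(H)$, or $v=v'$ and $uu'\in E(G)$. For a vertex-colored graph and two nonadjacent vertices $x,y$, an $x$-$y$ vertex cut is a set $S\subseteq V(G)\setminus\{x,y\}$ such that $x$ and $y$ lie in different components of $G-S$; it is monochromatic if all its vertices have the same color. A vertex-coloring is an MVD-coloring if every pair of nonadjacent vertices has a monochromatic vertex cut separating them. $mvd(G)$ is the maximum number of colors used by an MVD-coloring of $G$. -}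

module Defs where

open import Data.Nat using (ℕ; zero; suc; _≤_)
open import Data.Fin using (Fin; toℕ)
open import Data.Product using (Σ; ∃; _×_; _,_)
open import Data.Sum using (_⊎_)
open import Relation.Binary.PropositionalEquality using (_≡_; _≢_)
open import Relation.Nullary using (¬_)
open import Data.Fin using (_<_)

record Graph : Set₁ where
  field
    V   : Set
    Adj : V → V → Set

open Graph public

data ConnectedAvoiding (G : Graph) (S : V G → Set) : V G → V G → Set where
  here : ∀ {x} → ¬ S x → ConnectedAvoiding G S x x
  step : ∀ {x y z} → ¬ S x → Adj G x y → ConnectedAvoiding G S y z →
         ConnectedAvoiding G S x z

IsVertexCut : (G : Graph) → V G → V G → (V G → Set) → Set
IsVertexCut G x y S = ¬ S x × ¬ S y × ¬ ConnectedAvoiding G S x y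

UsesAll : (G : Graph) {k : ℕ} → (V G → Fin k) → Set
UsesAll G {k} c = (a : Fin k) → ∃ λ v → c v ≡ a

Monochromatic : (G : Graph) {k : ℕ} → (V G → Fin k) → (V G → Set) → Set
Monochromatic G {k} c S = ∃ λ (a : Fin k) → ∀ v → S v → c v ≡ a

IsMVD : (G : Graph) {k : ℕ} → (V G → Fin k) → Set₁
IsMVD G c = ∀ x y → x ≢ y → ¬ Adj G x y →
  Σ (V G → Set) λ S → IsVertexCut G x y S × Monochromatic G c S

MvdIs : Graph → ℕ → Set₁
MvdIs G k =
  (Σ (V G → Fin k) λ c → UsesAll G c × IsMVD G c) ×
  (∀ (k' : ℕ) (c : V G → Fin k') → UsesAll G c → IsMVD G c → k' ≤ k)

PathAdj : ∀ {m} → Fin m → Fin m → Set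
PathAdj i j = (toℕ j ≡ suc (toℕ i)) ⊎ (toℕ i ≡ suc (toℕ j))

Grid : ℕ → ℕ → Graph
Grid m n = record
  { V   = Fin m × Fin n
  ; Adj = λ { (u , v) (u' , v') →
              (u ≡ u' × PathAdj v v') ⊎ (v ≡ v' × PathAdj u u') } }

-- Petersen graph as the Kneser graph K(5,2): vertices are 2-subsets {i<j}
-- of {0,…,4}, adjacent iff disjoint.
PetersenV : Set
PetersenV = Σ (Fin 5 × Fin 5) λ { (i , j) → i < j }

Petersen : Graph
Petersen = record
  { V   = PetersenV
  ; Adj = λ { ((i , j) , _) ((k , l) , _) →
              i ≢ k × i ≢ l × j ≢ k × j ≢ l } }

{-# OPTIONS --safe #-}
-- In a proper 2-colouring the neighbourhood of x is monochromatic and isolates x, so bipartite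
-- graphs with an edge have mvd ≥ 2. Conversely, a common neighbour of x and y lies in every
-- x-y cut. Hence opposite vertices of an induced 4-cycle have equal colours, which propagates
-- over a grid and leaves only the colours of (0,0) and (0,1). On an induced 5-cycle each vertex
-- shares its colour with one of the two vertices opposite to it. In the Petersen graph every
-- edge lies on an induced 5-cycle with any third vertex at distance two from both of its ends,
-- and every path on three vertices lies on one; so the two ends of a bichromatic edge already
-- carry all the colours.
module Submission where

open import Defs
open import Data.Fin using (Fin; zero; suc; toℕ; inject₁; opposite; _<_; _<?_; _≟_)
open import Data.Fin.Induction using (<-weakInduction)
open import Data.Fin.Properties using (all?; any?; opposite-involutive; toℕ-inject₁; <-irrelevant; injective⇒≤)
open import Data.Nat using (ℕ; zero; suc; _+_; _≤_; _≥_; z≤n; s≤s)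
open import Data.Nat.Properties using (+-suc; 1+n≢n)
open import Data.Product using (∃; ∃₂; _×_; _,_; proj₁; proj₂)
open import Data.Product.Properties using (≡-dec)
open import Data.Sum using (_⊎_; inj₁; inj₂; swap)
open import Function using (_∘_; id)
open import Relation.Binary.PropositionalEquality using (_≡_; _≢_; refl; sym; trans; cong; subst; ≢-sym)
open import Relation.Nullary using (¬_; Dec; yes; no; contradiction)
open import Relation.Nullary.Decidable using (map′; ¬?; _×-dec_; _⊎-dec_; _→-dec_; decidable-stable; from-yes)
open import Relation.Unary using (Decidable)

-- Colour counts and cuts in an arbitrary graph

TwoValued : {A : Set} {k : ℕ} → (A → Fin k) → Set
TwoValued {k = k} c = ∃₂ λ (p q : Fin k) → ∀ v → c v ≡ p ⊎ c v ≡ q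

-- Surjectivity turns the bound on vertex colours into one on all of `Fin k`; recording which of `p`
-- and `q` a colour equals then embeds `Fin k` into `Fin 2`.
twoValued⇒≤2 : ∀ G {k} (c : V G → Fin k) → UsesAll G c → TwoValued c → k ≤ 2
twoValued⇒≤2 G {k} c surj (p , q , h) = injective⇒≤ side-injective
  where
  p-or-q : ∀ a → a ≡ p ⊎ a ≡ q
  p-or-q a with surj a
  ... | v , refl = h v

  side : Fin k → Fin 2
  side a with p-or-q a
  ... | inj₁ _ = zero
  ... | inj₂ _ = suc zero

  side-injective : ∀ {a b} → side a ≡ side b → a ≡ b
  side-injective {a} {b} e with p-or-q a | p-or-q b
  ... | inj₁ a≡p | inj₁ b≡p = trans a≡p (sym b≡p)
  ... | inj₂ a≡q | inj₂ b≡q = trans a≡q (sym b≡q)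

opposite-≢ : ∀ (a : Fin 2) → a ≢ opposite a
opposite-≢ zero       ()
opposite-≢ (suc zero) ()

module _ (G : Graph) where

  source-avoids : ∀ {S x y} → ConnectedAvoiding G S x y → ¬ S x
  source-avoids (here x∉S)     = x∉S
  source-avoids (step x∉S _ _) = x∉S

  outNeighbours-cut : ∀ {x y} → ¬ Adj G x x → x ≢ y → ¬ Adj G x y →
                      IsVertexCut G x y (Adj G x)
  outNeighbours-cut {x} {y} irr x≢y x≁y = irr , x≁y , disconnected
    where
    disconnected : ¬ ConnectedAvoiding G (Adj G x) x y
    disconnected (here _)          = x≢y refl
    disconnected (step _ x~u path) = source-avoids path x~u

  -- `Graph` does not make adjacency symmetric, so isolating the target takes in-neighbours: the
  -- last step into `y` from elsewhere would start in the cut.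
  inNeighbours-cut : ∀ {x y} → ¬ Adj G y y → x ≢ y → ¬ Adj G x y →
                     IsVertexCut G x y (λ v → Adj G v y)
  inNeighbours-cut {x} {y} irr x≢y x≁y = x≁y , irr , x≢y ∘ stationary
    where
    stationary : ∀ {u} → ConnectedAvoiding G (λ v → Adj G v y) u y → u ≡ y
    stationary (here _) = refl
    stationary (step u∉S u~v path) with stationary path
    ... | refl = contradiction u~v u∉S

  -- `S` is an arbitrary predicate, so `S z` cannot be decided, but equality of colours can. If it
  -- failed, `z` would lie outside `S` and the walk `x`, `z`, `y` would avoid the cut.
  commonNeighbour-colour : ∀ {k} (c : V G → Fin k) {S x y z} → IsVertexCut G x y S →
    ((a , _) : Monochromatic G c S) → Adj G x z → Adj G z y → c z ≡ a
  commonNeighbour-colour c {z = z} (x∉S , y∉S , cut) (a , mono) x~z z~y =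
    decidable-stable (c z ≟ a) λ cz≢a →
      cut (step x∉S x~z (step (cz≢a ∘ mono z) z~y (here y∉S)))

  square-colour : ∀ {k} (c : V G → Fin k) → IsMVD G c →
    ∀ {x y z w} → x ≢ y → ¬ Adj G x y →
    Adj G x z → Adj G z y → Adj G x w → Adj G w y → c z ≡ c w
  square-colour c mvd {x} {y} x≢y x≁y x~z z~y x~w w~y with mvd x y x≢y x≁y
  ... | S , cut , mono = trans (commonNeighbour-colour c cut mono x~z z~y)
                          (sym (commonNeighbour-colour c cut mono x~w w~y))

  -- The cut has the colour of `z`. If neither `w₁` nor `w₂` had it, both would lie outside the cut
  -- and the walk through them would survive.
  pentagon-colour : ∀ {k} (c : V G → Fin k) → IsMVD G c →
    ∀ {x y z w₁ w₂} → x ≢ y → ¬ Adj G x y →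
    Adj G x z → Adj G z y → Adj G x w₁ → Adj G w₁ w₂ → Adj G w₂ y →
    c z ≡ c w₁ ⊎ c z ≡ c w₂
  pentagon-colour c mvd {x} {y} {z} {w₁} {w₂} x≢y x≁y x~z z~y x~w₁ w₁~w₂ w₂~y
    with c z ≟ c w₁ | c z ≟ c w₂
  ... | yes e | _     = inj₁ e
  ... | no _  | yes e = inj₂ e
  ... | no ¬e | no ¬f with mvd x y x≢y x≁y
  ... | S , cut@(x∉S , y∉S , sep) , mono@(a , S⊆a) = contradiction
    (step x∉S x~w₁ (step (λ s → ¬e (trans cz≡a (sym (S⊆a w₁ s)))) w₁~w₂
      (step (λ s → ¬f (trans cz≡a (sym (S⊆a w₂ s)))) w₂~y (here y∉S)))) sep
    where
    cz≡a : c z ≡ a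
    cz≡a = commonNeighbour-colour c cut mono x~z z~y

  bipartite⇒MVD : (c : V G → Fin 2) → (∀ {x y} → Adj G x y → c y ≡ opposite (c x)) →
                  IsMVD G c
  bipartite⇒MVD c proper x y x≢y x≁y =
    Adj G x , outNeighbours-cut (λ x~x → opposite-≢ (c x) (proper x~x)) x≢y x≁y ,
    opposite (c x) , λ _ → proper

-- Grids

alternate : ℕ → Fin 2
alternate zero    = zero
alternate (suc n) = opposite (alternate n)

checkerboard : ∀ {m n} → V (Grid m n) → Fin 2
checkerboard (i , j) = alternate (toℕ i + toℕ j)

checkerboard-proper : ∀ {m n} {x y : V (Grid m n)} → Adj (Grid m n) x y →
                      checkerboard y ≡ opposite (checkerboard x)
checkerboard-proper {x = i , j} {_ , j′} (inj₁ (refl , inj₁ e)) =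
  cong alternate (trans (cong (toℕ i +_) e) (+-suc _ _))
checkerboard-proper {x = i , j} {_ , j′} (inj₁ (refl , inj₂ e)) =
  trans (sym (opposite-involutive _))
    (cong opposite (sym (cong alternate (trans (cong (toℕ i +_) e) (+-suc _ _)))))
checkerboard-proper {x = i , j} (inj₂ (refl , inj₁ e)) =
  cong (λ t → alternate (t + toℕ j)) e
checkerboard-proper {x = i , j} (inj₂ (refl , inj₂ e)) =
  trans (sym (opposite-involutive _))
    (cong opposite (sym (cong (λ t → alternate (t + toℕ j)) e)))

checkerboard-MVD : ∀ m n → IsMVD (Grid m n) checkerboard
checkerboard-MVD m n = bipartite⇒MVD (Grid m n) checkerboard (checkerboard-proper {m} {n})

inject₁≢suc : ∀ {n} (i : Fin n) → inject₁ i ≢ suc i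
inject₁≢suc i e = 1+n≢n (trans (cong toℕ (sym e)) (toℕ-inject₁ i))

inject₁~suc : ∀ {n} (i : Fin n) → PathAdj (inject₁ i) (suc i)
inject₁~suc i = inj₁ (cong suc (sym (toℕ-inject₁ i)))

module _ {m n k} (c : V (Grid (suc m) (suc n)) → Fin k) (mvd : IsMVD (Grid (suc m) (suc n)) c) where

  -- The separated pair is the other diagonal of a unit square; `inject₁ i` and `suc i` are
  -- consecutive positions in one `Fin`.
  antidiagonal-colour : ∀ i j → c (suc i , inject₁ j) ≡ c (inject₁ i , suc j)
  antidiagonal-colour i j = square-colour (Grid (suc m) (suc n)) c mvd
    {inject₁ i , inject₁ j} {suc i , suc j}
    (inject₁≢suc i ∘ cong proj₁)
    (λ { (inj₁ (e , _)) → inject₁≢suc i e ; (inj₂ (e , _)) → inject₁≢suc j e })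
    (inj₂ (refl , inject₁~suc i)) (inj₁ (refl , inject₁~suc j))
    (inj₁ (refl , inject₁~suc j)) (inj₂ (refl , inject₁~suc i))

  diagonal-colour : ∀ i j → c (suc i , suc j) ≡ c (inject₁ i , inject₁ j)
  diagonal-colour i j = square-colour (Grid (suc m) (suc n)) c mvd
    {inject₁ i , suc j} {suc i , inject₁ j}
    (inject₁≢suc i ∘ cong proj₁)
    (λ { (inj₁ (e , _)) → inject₁≢suc i e ; (inj₂ (e , _)) → inject₁≢suc j (sym e) })
    (inj₂ (refl , inject₁~suc i)) (inj₁ (refl , swap (inject₁~suc j)))
    (inj₁ (refl , swap (inject₁~suc j))) (inj₂ (refl , inject₁~suc i))

grid-twoValued : ∀ {m n k} (c : V (Grid (2 + m) (2 + n)) → Fin k) →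
                 IsMVD (Grid (2 + m) (2 + n)) c → TwoValued c
grid-twoValued {m} {n} c mvd = p , q , λ (i , j) → allRows i j
  where
  p = c (zero , zero)
  q = c (zero , suc zero)

  Good : V (Grid (2 + m) (2 + n)) → Set
  Good v = c v ≡ p ⊎ c v ≡ q

  transport : ∀ {v w} → c v ≡ c w → Good w → Good v
  transport e = subst (λ a → a ≡ p ⊎ a ≡ q) (sym e)

  -- Going down one row and back up, the two diagonal equalities give `(0, j + 2)` the colour of
  -- `(0, j)`, so the induction carries two consecutive cells.
  firstRow-pairs : ∀ j → Good (zero , inject₁ j) × Good (zero , suc j)
  firstRow-pairs = <-weakInduction _ (inj₁ refl , inj₂ refl) λ j (g , g′) →
    g′ , transport (trans (sym (antidiagonal-colour c mvd zero (suc j)))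
                          (diagonal-colour c mvd zero (inject₁ j))) g

  firstRow : ∀ j → Good (zero , j)
  firstRow zero    = inj₁ refl
  firstRow (suc j) = proj₂ (firstRow-pairs j)

  nextRow : ∀ i → (∀ j → Good (inject₁ i , j)) → ∀ j → Good (suc i , j)
  -- The first column has no cell up and to the left, so its colour comes from the upper right.
  nextRow i row zero    = transport (antidiagonal-colour c mvd i zero) (row (suc zero))
  nextRow i row (suc j) = transport (diagonal-colour c mvd i j) (row (inject₁ j))

  allRows : ∀ i j → Good (i , j)
  allRows = <-weakInduction _ firstRow nextRow

grid-mvd : ∀ m n → (m ≥ 2 × n ≥ 2) ⊎ ((m ≡ 1 × n ≡ 2) ⊎ (m ≡ 2 × n ≡ 1)) →
           MvdIs (Grid m n) 2
grid-mvd m@(suc (suc _)) n@(suc (suc _)) (inj₁ _) =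
  (checkerboard , (λ { zero → (zero , zero) , refl ; (suc zero) → (zero , suc zero) , refl })
                , checkerboard-MVD m n) ,
  λ _ c surj mvd → twoValued⇒≤2 (Grid m n) c surj (grid-twoValued c mvd)
grid-mvd (suc (suc _)) zero       (inj₁ (_ , ()))
grid-mvd (suc (suc _)) (suc zero) (inj₁ (_ , s≤s ()))
grid-mvd zero          _          (inj₁ (() , _))
grid-mvd (suc zero)    _          (inj₁ (s≤s () , _))
grid-mvd m n (inj₂ (inj₁ (refl , refl))) =
  (checkerboard , (λ { zero → (zero , zero) , refl ; (suc zero) → (zero , suc zero) , refl })
                , checkerboard-MVD 1 2) ,
  λ _ c surj _ → twoValued⇒≤2 (Grid 1 2) c surj
    (c (zero , zero) , c (zero , suc zero) ,
     λ { (zero , zero) → inj₁ refl ; (zero , suc zero) → inj₂ refl })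
grid-mvd m n (inj₂ (inj₂ (refl , refl))) =
  (checkerboard , (λ { zero → (zero , zero) , refl ; (suc zero) → (suc zero , zero) , refl })
                , checkerboard-MVD 2 1) ,
  λ _ c surj _ → twoValued⇒≤2 (Grid 2 1) c surj
    (c (zero , zero) , c (suc zero , zero) ,
     λ { (zero , zero) → inj₁ refl ; (suc zero , zero) → inj₂ refl })

-- The Petersen graph

_~_ : PetersenV → PetersenV → Set
_~_ = Adj Petersen

_~?_ : ∀ u v → Dec (u ~ v)
((i , j) , _) ~? ((k , l) , _) =
  ¬? (i ≟ k) ×-dec ¬? (i ≟ l) ×-dec ¬? (j ≟ k) ×-dec ¬? (j ≟ l)

~-sym : ∀ u v → u ~ v → v ~ u
~-sym _ _ (i≢k , i≢l , j≢k , j≢l) = ≢-sym i≢k , ≢-sym j≢k , ≢-sym i≢l , ≢-sym j≢l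

~-irrefl : ∀ u → ¬ (u ~ u)
~-irrefl _ (i≢i , _) = i≢i refl

_≟ᵥ_ : (u v : PetersenV) → Dec (u ≡ v)
_≟ᵥ_ = ≡-dec (≡-dec _≟_ _≟_) λ p q → yes (<-irrelevant p q)

-- Proofs of `i < j` are all equal, so testing one per pair of indices is enough.
∀ᵥ? : ∀ {P : PetersenV → Set} → Decidable P → Dec (∀ v → P v)
∀ᵥ? {P} P? = map′ (λ f ((i , j) , i<j) → f i j i<j) (λ f i j i<j → f ((i , j) , i<j))
  (all? λ i → all? λ j → given i j (i <? j))
  where
  given : ∀ i j → Dec (i < j) → Dec ((i<j : i < j) → P ((i , j) , i<j))
  given i j (no  i≮j) = yes λ i<j → contradiction i<j i≮j
  given i j (yes i<j) = map′ (λ p i<j′ → subst (λ r → P ((i , j) , r)) (<-irrelevant i<j i<j′) p)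
                             (λ f → f i<j) (P? ((i , j) , i<j))

∃ᵥ? : ∀ {P : PetersenV → Set} → Decidable P → Dec (∃ P)
∃ᵥ? {P} P? = map′ (λ (i , j , i<j , p) → ((i , j) , i<j) , p) (λ (((i , j) , i<j) , p) → i , j , i<j , p)
  (any? λ i → any? λ j → given i j (i <? j))
  where
  given : ∀ i j → Dec (i < j) → Dec (∃ λ (i<j : i < j) → P ((i , j) , i<j))
  given i j (no  i≮j) = no λ (i<j , _) → i≮j i<j
  given i j (yes i<j) = map′ (i<j ,_) (λ (i<j′ , p) → subst (λ r → P ((i , j) , r)) (<-irrelevant i<j′ i<j) p)
                             (P? ((i , j) , i<j))

-- Abstract, so that the witnesses found by enumeration are never unfolded.
abstract
  triangle-free : ∀ u v → u ~ v → ∀ w → v ~ w → ¬ (u ~ w)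
  triangle-free = from-yes (∀ᵥ? λ u → ∀ᵥ? λ v → (u ~? v) →-dec ∀ᵥ? λ w → (v ~? w) →-dec ¬? (u ~? w))

  -- Two distinct intersecting pairs cover three of the five elements; the other two form a common
  -- neighbour.
  diameter≤2 : ∀ u v → u ≡ v ⊎ u ~ v ⊎ ∃ λ w → u ~ w × w ~ v
  diameter≤2 = from-yes (∀ᵥ? λ u → ∀ᵥ? λ v →
    (u ≟ᵥ v) ⊎-dec (u ~? v) ⊎-dec ∃ᵥ? λ w → (u ~? w) ×-dec (w ~? v))

  path-in-pentagon : ∀ u v → u ~ v → ∀ w → v ~ w → u ≢ w →
    ∃ λ a → w ~ a × ∃ λ b → a ~ b × b ~ u
  path-in-pentagon = from-yes (∀ᵥ? λ u → ∀ᵥ? λ v → (u ~? v) →-dec ∀ᵥ? λ w → (v ~? w) →-dec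
    ¬? (u ≟ᵥ w) →-dec ∃ᵥ? λ a → (w ~? a) ×-dec ∃ᵥ? λ b → (a ~? b) ×-dec (b ~? u))

-- Upper bound for the Petersen graph

module _ {k} (c : PetersenV → Fin k) (mvd : IsMVD Petersen c) where

  -- No distinctness is assumed: without triangles, a closed walk of length five is an
  -- induced pentagon.
  closedWalk-colour : ∀ {v₀ v₁ v₂ v₃ v₄} → v₀ ~ v₁ → v₁ ~ v₂ → v₂ ~ v₃ → v₃ ~ v₄ → v₄ ~ v₀ →
                      c v₀ ≡ c v₂ ⊎ c v₀ ≡ c v₃
  closedWalk-colour {v₀} {v₁} {v₂} {v₃} {v₄} e₀ e₁ e₂ e₃ e₄ =
    pentagon-colour Petersen c mvd {v₁} {v₄}
      (λ { refl → triangle-free v₁ v₂ e₁ v₃ e₂ (~-sym v₃ v₁ e₃) })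
      (λ v₁~v₄ → triangle-free v₁ v₄ v₁~v₄ v₀ e₄ (~-sym v₀ v₁ e₀))
      (~-sym v₀ v₁ e₀) (~-sym v₄ v₀ e₄) e₁ e₂ e₃

  path-colour : ∀ u v w → u ~ v → v ~ w → c u ≢ c v → c w ≡ c u ⊎ c w ≡ c v
  path-colour u v w u~v v~w cu≢cv with u ≟ᵥ w
  ... | yes refl = inj₁ refl
  ... | no  u≢w with path-in-pentagon u v u~v w v~w u≢w
  ... | a , w~a , b , a~b , b~u
    -- The pentagon is read from `u`, `v` and `w` in turn. If `w` does not share the colour of `u`,
    -- then `u` matches `a`, which forces `v` to match `b`, and so does `w`.
    with closedWalk-colour {u} {v} {w} {a} {b} u~v v~w w~a a~b b~u
       | closedWalk-colour {v} {w} {a} {b} {u} v~w w~a a~b b~u u~v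
       | closedWalk-colour {w} {a} {b} {u} {v} w~a a~b b~u u~v v~w
  ... | _       | _       | inj₂ w≡u = inj₁ w≡u
  ... | inj₁ u≡w | _       | inj₁ _   = inj₁ (sym u≡w)
  ... | inj₂ u≡a | inj₁ v≡a | inj₁ _   = contradiction (trans u≡a (sym v≡a)) cu≢cv
  ... | inj₂ _   | inj₂ v≡b | inj₁ w≡b = inj₂ (trans w≡b (sym v≡b))

  edge-colour : ∀ u v → u ~ v → c u ≢ c v → ∀ w → c w ≡ c u ⊎ c w ≡ c v
  edge-colour u v u~v cu≢cv w with diameter≤2 u w | diameter≤2 v w
  ... | inj₁ refl       | _               = inj₁ refl
  ... | _               | inj₁ refl       = inj₂ refl
  ... | inj₂ (inj₁ u~w) | _               = swap (path-colour v u w (~-sym u v u~v) u~w (≢-sym cu≢cv))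
  ... | _               | inj₂ (inj₁ v~w) = path-colour u v w u~v v~w cu≢cv
  -- Here `u` and `v` are the two vertices opposite to `w` on the pentagon.
  ... | inj₂ (inj₂ (a , u~a , a~w)) | inj₂ (inj₂ (b , v~b , b~w)) =
    closedWalk-colour {w} {a} {u} {v} {b} (~-sym a w a~w) (~-sym u a u~a) u~v v~b b~w

  petersen-twoValued : TwoValued c
  petersen-twoValued with ∃ᵥ? (λ u → ∃ᵥ? λ v → (u ~? v) ×-dec ¬? (c u ≟ c v))
  ... | yes (u , v , u~v , cu≢cv) = c u , c v , edge-colour u v u~v cu≢cv
  -- By connectedness `c` is then constant, so both values are the colour of any one vertex.
  ... | no  noBichromaticEdge     = c root , c root , λ v → inj₁ (sym (constant v))
    where
    root : PetersenV
    root = (zero , suc zero) , s≤s z≤n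

    monochromaticEdge : ∀ u v → u ~ v → c u ≡ c v
    monochromaticEdge u v u~v = decidable-stable (c u ≟ c v) λ cu≢cv →
      noBichromaticEdge (u , v , u~v , cu≢cv)

    constant : ∀ v → c root ≡ c v
    constant v with diameter≤2 root v
    ... | inj₁ refl                     = refl
    ... | inj₂ (inj₁ r~v)               = monochromaticEdge root v r~v
    ... | inj₂ (inj₂ (w , r~w , w~v)) = trans (monochromaticEdge root w r~w) (monochromaticEdge w v w~v)

-- The star {0,j} is independent, and deleting it leaves a perfect matching; so a pair
-- meeting the star is separated by a neighbourhood, any other one by the star.
star : PetersenV → Fin 2
star ((zero  , _) , _) = zero
star ((suc _ , _) , _) = suc zero

star-independent : ∀ u v → u ~ v → star u ≡ zero → star v ≡ suc zero
star-independent ((zero , _) , _) ((zero  , _) , _) (i≢k , _) _ = contradiction refl i≢k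
star-independent ((zero , _) , _) ((suc _ , _) , _) _         _ = refl

abstract
  -- Among the pairs inside {1,2,3,4}, each is disjoint only from its complement.
  star-complement-matching : ∀ u → star u ≡ suc zero → ∀ v → star v ≡ suc zero → u ~ v →
    ∀ w → star w ≡ suc zero → v ~ w → u ≡ w
  star-complement-matching = from-yes (∀ᵥ? λ u → (star u ≟ suc zero) →-dec ∀ᵥ? λ v →
    (star v ≟ suc zero) →-dec (u ~? v) →-dec ∀ᵥ? λ w → (star w ≟ suc zero) →-dec
    (v ~? w) →-dec (u ≟ᵥ w))

star-MVD : IsMVD Petersen star
star-MVD x y x≢y x≁y with star x in ex | star y in ey
... | zero | _ = x ~_ , outNeighbours-cut Petersen {x} (~-irrefl x) x≢y x≁y ,
  suc zero , λ v x~v → star-independent x v x~v ex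
... | suc zero | zero = _~ y , inNeighbours-cut Petersen {x} {y} (~-irrefl y) x≢y x≁y ,
  suc zero , λ v v~y → star-independent y v (~-sym v y v~y) ey
... | suc zero | suc zero = S , (outside x ex , outside y ey , separated) , zero , λ _ → id
  where
  S : PetersenV → Set
  S v = star v ≡ zero

  outside : ∀ v → star v ≡ suc zero → ¬ S v
  outside v e s with trans (sym e) s
  ... | ()

  nonzero⇒one : ∀ (a : Fin 2) → a ≢ zero → a ≡ suc zero
  nonzero⇒one zero       a≢0 = contradiction refl a≢0
  nonzero⇒one (suc zero) _   = refl

  -- Off the star, a neighbour of `x` leads only back to `x`, so a walk from `x` never leaves `x`
  -- and its neighbours.
  confined : ∀ {u} → ConnectedAvoiding Petersen S u y → x ≡ u ⊎ x ~ u → x ≡ y ⊎ x ~ y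
  confined (here _) near = near
  confined (step {y = v} _ x~v path) (inj₁ refl) = confined path (inj₂ x~v)
  confined (step {u} {v} u∉S u~v path) (inj₂ x~u) = confined path (inj₁
    (star-complement-matching x ex u (nonzero⇒one _ u∉S) x~u v
      (nonzero⇒one _ (source-avoids Petersen path)) u~v))

  separated : ¬ ConnectedAvoiding Petersen S x y
  separated path with confined path (inj₁ refl)
  ... | inj₁ x≡y = x≢y x≡y
  ... | inj₂ x~y = x≁y x~y

petersen-mvd : MvdIs Petersen 2
petersen-mvd =
  (star , (λ { zero       → ((zero , suc zero) , s≤s z≤n) , refl
             ; (suc zero) → ((suc zero , suc (suc zero)) , s≤s (s≤s z≤n)) , refl })
        , star-MVD) ,
  λ _ c surj mvd → twoValued⇒≤2 Petersen c surj (petersen-twoValued c mvd)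

theorem3p2 : (∀ (m n : ℕ) →
    ((m ≥ 2 × n ≥ 2) ⊎ ((m ≡ 1 × n ≡ 2) ⊎ (m ≡ 2 × n ≡ 1))) →
    MvdIs (Grid m n) 2)
    × MvdIs Petersen 2
theorem3p2 = grid-mvd , petersen-mvd
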